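{- Let $\nu\ge 1$ be an integer. The automorphism group of the graph $Sp(2\nu,2)$ is isomorphic to the symplectic group of degree $2\nu$ over $\mathbb{F}_2$: $$\mathrm{Aut}(Sp(2\nu,2))\cong Sp_{2\nu}(\mathbb{F}_2).$$
   Context: For a prime power $q$, let $\mathbb{F}_q^{(2\nu)}$ be the $2\nu$-dimensional space of row vectors over the finite field $\mathbb{F}_q$. Let $K$ be the $2\nu\times 2\nu$ block diagonal matrix over $\mathbb{F}_q$ with $\nu$ diagonal blocks all equal to $\begin{pmatrix}0&1\\-1&0\end{pmatrix}$. For a nonzero row vector $\alpha$, $[\alpha]$ denotes the one-dimensional subspace spanned by $\alpha$. The symplectic graph $Sp(2\nu,q)$ is the simple undirected graph whose vertices are the one-dimensional subspaces of $\mathbb{F}_q^{(2\nu)}$, with $[\alpha]$ adjacent to $[\beta]$ if and only if $\alpha K\,{}^t\!\beta\neq 0$ (where ${}^t\!\beta$ is the transpose of $\beta$). $\mathrm{Aut}(Sp(2\nu,q))$ is its group of graph automorphisms. The symplectic group $Sp_{2\nu}(\mathbb{F}_q)$ is the group of all $2\nu\times 2\nu$ matrices $T$ over $\mathbb{F}_q$ with $T K\,{}^t T=K$, under matrix multiplication. Here $q=2$. -}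

module Defs where

open import Algebra.Bundles using (CommutativeRing; Group)
open import Algebra.Morphism.Structures using (module GroupMorphisms)
import Algebra.Properties.Semiring.Sum as Sum
open import Data.Bool.Base using (if_then_else_)
open import Data.Bool.Properties using (xor-∧-commutativeRing)
open import Data.Fin.Base
  using (Fin; zero; suc; quotient; remainder; punchOut; funToFin; finToFun; combine)
open import Data.Fin.Properties
  using (_≟_; any?; punchOut-injective; injective⇒≤; 2↔Bool; finToFun-funToFin; funToFin-finToFin)
open import Data.Nat.Base using (ℕ; zero; suc; _*_; _^_)
open import Data.Nat.Properties using (1+n≰n)
open import Data.Product.Base using (∃-syntax; _,_)
open import Data.Vec.Functional using (Vector)
open import Function.Base using (_∘_)
open import Function.Bundles using (Inverse; Equivalence; _⇔_; mk⇔)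
import Function.Construct.Composition as Comp
import Function.Construct.Identity as Id
import Function.Construct.Symmetry as Symm
open import Function.Definitions using (Injective)
open import Level using (Level; _⊔_; 0ℓ) renaming (suc to lsuc)
open import Relation.Binary.Bundles using (Setoid)
open import Relation.Binary.Core using (Rel)
open import Relation.Binary.Definitions using (Symmetric)
import Relation.Binary.Reasoning.Setoid as SetoidReasoning
open import Relation.Binary.PropositionalEquality
  using (_≡_; _≢_; _≗_; refl; sym; trans; cong; cong₂; module ≡-Reasoning)
open import Relation.Nullary.Decidable using (does; yes; no)
open import Relation.Nullary.Negation using (¬_; contradiction)
open import Relation.Unary using (Pred; _≐_)
open import Relation.Unary.Properties using (≐-refl; ≐-sym; ≐-trans)

private variable
  c ℓ c₁ ℓ₁ c₂ ℓ₂ : Level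
  m n k ν : ℕ

infix 4 _≅_

_≅_ : Group c₁ ℓ₁ → Group c₂ ℓ₂ → Set (c₁ ⊔ ℓ₁ ⊔ c₂ ⊔ ℓ₂)
G ≅ H = ∃[ f ] IsGroupIsomorphism f
  where open GroupMorphisms (Group.rawGroup G) (Group.rawGroup H)

record Graph (v e a : Level) : Set (lsuc (v ⊔ e ⊔ a)) where
  field
    vertices : Setoid v e

  open Setoid vertices public using () renaming (Carrier to Vertex; _≈_ to _≈ᵛ_)

  field
    _~_      : Rel Vertex a
    ~-resp-≈ : ∀ {x x′ y y′} → x ≈ᵛ x′ → y ≈ᵛ y′ → x ~ y → x′ ~ y′
    ~-sym    : Symmetric _~_
    ~-irrefl : ∀ {x} → ¬ (x ~ x)

module _ {v e a : Level} (Γ : Graph v e a) where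
  open Graph Γ
  private module V = Setoid vertices

  record Automorphism : Set (v ⊔ e ⊔ a) where
    field
      inverse   : Inverse vertices vertices
    open Inverse inverse public using (to; from)
    field
      preserves : ∀ x y → x ~ y ⇔ to x ~ to y

  open Automorphism

  Aut : Group (v ⊔ e ⊔ a) (v ⊔ e)
  Aut = record
    { Carrier = Automorphism
    ; _≈_     = λ f g → ∀ x → to f x ≈ᵛ to g x
    ; _∙_     = λ f g → record
      { inverse   = Comp.inverse (inverse g) (inverse f)
      ; preserves = λ x y → Comp.equivalence (preserves g x y) (preserves f (to g x) (to g y))
      }
    ; ε       = record
      { inverse   = Id.inverse vertices
      ; preserves = λ x y → mk⇔ (λ p → p) (λ p → p)
      }
    ; _⁻¹     = λ f → record
      { inverse   = Symm.inverse (inverse f)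
      ; preserves = λ x y →
          let open Equivalence (preserves f (from f x) (from f y))
                using () renaming (to to fwd; from to bwd)
              module I = Inverse (inverse f)
          in mk⇔
            (λ x~y → bwd (~-resp-≈ (V.sym (I.strictlyInverseˡ x)) (V.sym (I.strictlyInverseˡ y)) x~y))
            (λ p → ~-resp-≈ (I.strictlyInverseˡ x) (I.strictlyInverseˡ y) (fwd p))
      }
    ; isGroup = record
      { isMonoid = record
        { isSemigroup = record
          { isMagma = record
            { isEquivalence = record
              { refl  = λ x → V.refl
              ; sym   = λ p x → V.sym (p x)
              ; trans = λ p q x → V.trans (p x) (q x)
              }
            ; ∙-cong = λ {f} {_} {_} {g′} p q x →
                V.trans (Inverse.to-cong (inverse f) (q x)) (p (to g′ x))
            }
          ; assoc = λ f g h x → V.refl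
          }
        ; identity = (λ f x → V.refl) , (λ f x → V.refl)
        }
      ; inverse = (λ f → Inverse.strictlyInverseʳ (inverse f))
                , (λ f → Inverse.strictlyInverseˡ (inverse f))
      ; ⁻¹-cong = λ {f} {g} p x →
          let module F = Inverse (inverse f)
              module G = Inverse (inverse g)
          in V.trans (F.from-cong (V.trans (V.sym (G.strictlyInverseˡ x))
                                           (V.sym (p (G.from x)))))
                     (F.strictlyInverseʳ (G.from x))
      }
    }

𝔽₂ : CommutativeRing 0ℓ 0ℓ
𝔽₂ = xor-∧-commutativeRing

module 𝔽 = CommutativeRing 𝔽₂
open 𝔽 using (0#; 1#; -_) renaming (_+_ to _+ᶠ_; _*_ to _·_)
open Sum 𝔽.semiring using (sum; sum-syntax; sum-cong-≗; sum-replicate-zero;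
  ∑-comm; *-distribˡ-sum; *-distribʳ-sum)

Row : ℕ → Set
Row n = Vector 𝔽.Carrier n

𝟘 : Row n
𝟘 _ = 0#

infixr 8 _•_
_•_ : 𝔽.Carrier → Row n → Row n
(c • α) i = c · α i

-- dot α β is the 1×1 matrix α ᵗβ.
dot : Row n → Row n → 𝔽.Carrier
dot {n} α β = ∑[ i < n ] (α i · β i)

Matrix : ℕ → ℕ → Set
Matrix m n = Vector (Row n) m

infix 4 _≋_
_≋_ : Rel (Matrix m n) 0ℓ
M ≋ N = ∀ i → M i ≗ N i

infixl 7 _⊛_ _⊗_
infix 9 ᵗ_

_⊛_ : Row m → Matrix m n → Row n
_⊛_ {m} α M j = ∑[ i < m ] (α i · M i j)

_⊗_ : Matrix m n → Matrix n k → Matrix m k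
(M ⊗ N) i = M i ⊛ N

ᵗ_ : Matrix m n → Matrix n m
(ᵗ M) i j = M j i

𝟙 : Matrix n n
𝟙 i j = if does (i ≟ j) then 1# else 0#

-- The index set Fin (ν * b) is cut into ν consecutive intervals of length b:
-- quotient gives the interval of an index, remainder its position there.
blockDiagonal : ∀ ν {b} → Matrix b b → Matrix (ν * b) (ν * b)
blockDiagonal ν {b} B i j =
  if does (quotient {ν} b i ≟ quotient {ν} b j)
  then B (remainder {ν} b i) (remainder {ν} b j)
  else 0#

J : Matrix 2 2
J zero       zero       = 0#
J zero       (suc zero) = 1#
J (suc zero) zero       = - 1#
J (suc zero) (suc zero) = 0#

K : ∀ ν → Matrix (ν * 2) (ν * 2)
K ν = blockDiagonal ν J

form : ∀ ν → Row (ν * 2) → Row (ν * 2) → 𝔽.Carrier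
form ν α β = dot (α ⊛ K ν) β

dot-cong : {α α′ β β′ : Row n} → α ≗ α′ → β ≗ β′ → dot α β ≡ dot α′ β′
dot-cong p q = sum-cong-≗ λ i → cong₂ _·_ (p i) (q i)

⊛-cong : {α β : Row m} {M N : Matrix m n} → α ≗ β → M ≋ N → α ⊛ M ≗ β ⊛ N
⊛-cong p q j = sum-cong-≗ λ i → cong₂ _·_ (p i) (q i j)

form-cong : ∀ ν {α α′ β β′} → α ≗ α′ → β ≗ β′ → form ν α β ≡ form ν α′ β′
form-cong ν p q = dot-cong (⊛-cong p λ _ _ → refl) q

⊛-assoc : (α : Row m) (M : Matrix m n) (N : Matrix n k) → α ⊛ M ⊛ N ≗ α ⊛ (M ⊗ N)
⊛-assoc {m} {n} α M N j = begin
  ∑[ b < n ] ((∑[ a < m ] (α a · M a b)) · N b j)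
    ≡⟨ sum-cong-≗ (λ b → *-distribʳ-sum (N b j) (λ a → α a · M a b)) ⟩
  ∑[ b < n ] ∑[ a < m ] (α a · M a b · N b j)
    ≡⟨ ∑-comm (λ b a → α a · M a b · N b j) ⟩
  ∑[ a < m ] ∑[ b < n ] (α a · M a b · N b j)
    ≡⟨ sum-cong-≗ (λ a → sum-cong-≗ λ b → 𝔽.*-assoc (α a) (M a b) (N b j)) ⟩
  ∑[ a < m ] ∑[ b < n ] (α a · (M a b · N b j))
    ≡⟨ sum-cong-≗ (λ a → *-distribˡ-sum (α a) (λ b → M a b · N b j)) ⟨
  ∑[ a < m ] (α a · ∑[ b < n ] (M a b · N b j)) ∎
  where open ≡-Reasoning

sum-zero : {t : Row n} → t ≗ 𝟘 → sum t ≡ 0#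
sum-zero {n} p = trans (sum-cong-≗ p) (sum-replicate-zero n)

⊛-identityˡ : (i : Fin m) (M : Matrix m n) → 𝟙 i ⊛ M ≗ M i
⊛-identityˡ {suc m} zero M j =
  trans (cong (M zero j +ᶠ_) (sum-zero {m} {𝟘} λ _ → refl)) (𝔽.+-identityʳ _)
⊛-identityˡ (suc i) M j =
  ⊛-identityˡ i (M ∘ suc) j

𝟙-sym : (i j : Fin n) → 𝟙 i j ≡ 𝟙 j i
𝟙-sym zero    zero    = refl
𝟙-sym zero    (suc j) = refl
𝟙-sym (suc i) zero    = refl
𝟙-sym (suc i) (suc j) = 𝟙-sym i j

⊛-identityʳ : (α : Row n) → α ⊛ 𝟙 ≗ α
⊛-identityʳ α j =
  trans (sum-cong-≗ λ i → trans (𝔽.*-comm (α i) (𝟙 i j)) (cong (_· α i) (𝟙-sym i j)))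
        (⊛-identityˡ j (λ i _ → α i) j)

matrixSetoid : ℕ → ℕ → Setoid 0ℓ 0ℓ
matrixSetoid m n = record
  { Carrier       = Matrix m n
  ; _≈_           = _≋_
  ; isEquivalence = record
    { refl  = λ _ _ → refl
    ; sym   = λ p i j → sym (p i j)
    ; trans = λ p q i j → trans (p i j) (q i j)
    }
  }

module ≋ {m n : ℕ} = Setoid (matrixSetoid m n)

⊗-cong : {M M′ : Matrix m n} {N N′ : Matrix n k} → M ≋ M′ → N ≋ N′ → M ⊗ N ≋ M′ ⊗ N′
⊗-cong p q i = ⊛-cong (p i) q

⊗-assoc : ∀ {l} (M : Matrix l m) (N : Matrix m n) (P : Matrix n k) → M ⊗ N ⊗ P ≋ M ⊗ (N ⊗ P)
⊗-assoc M N P i = ⊛-assoc (M i) N P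

⊗-identityˡ : (M : Matrix m n) → 𝟙 ⊗ M ≋ M
⊗-identityˡ M i = ⊛-identityˡ i M

⊗-identityʳ : (M : Matrix m n) → M ⊗ 𝟙 ≋ M
⊗-identityʳ M i = ⊛-identityʳ (M i)

ᵗ-⊗ : (M : Matrix m n) (N : Matrix n k) → ᵗ (M ⊗ N) ≋ ᵗ N ⊗ ᵗ M
ᵗ-⊗ M N i j = sum-cong-≗ λ a → 𝔽.*-comm (M j a) (N a i)

K-ᵗK : ∀ ν → K ν ⊗ ᵗ K ν ≋ 𝟙
K-ᵗK (suc ν) zero          zero          = cong (1# +ᶠ_) (sum-zero {ν * 2} λ _ → refl)
K-ᵗK (suc ν) zero          (suc zero)    = sum-zero {ν * 2} λ _ → refl
K-ᵗK (suc ν) zero          (suc (suc j)) = sum-zero {ν * 2} λ _ → refl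
K-ᵗK (suc ν) (suc zero)    zero          = sum-zero {ν * 2} λ _ → refl
K-ᵗK (suc ν) (suc zero)    (suc zero)    = cong (1# +ᶠ_) (sum-zero {ν * 2} λ _ → refl)
K-ᵗK (suc ν) (suc zero)    (suc (suc j)) = sum-zero {ν * 2} λ _ → refl
K-ᵗK (suc ν) (suc (suc i)) zero          = sum-zero {ν * 2} λ a → 𝔽.zeroʳ (K ν i a)
K-ᵗK (suc ν) (suc (suc i)) (suc zero)    = sum-zero {ν * 2} λ a → 𝔽.zeroʳ (K ν i a)
K-ᵗK (suc ν) (suc (suc i)) (suc (suc j)) = K-ᵗK ν i j

form-suc : ∀ ν (α β : Row (suc ν * 2)) →
  form (suc ν) α β ≡
    (α (suc zero) · β zero +ᶠ α zero · β (suc zero)) +ᶠ form ν (λ i → α (suc (suc i))) (λ i → β (suc (suc i)))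
form-suc ν α β = trans (dot-cong {β = β} row (λ _ → refl)) (sym (𝔽.+-assoc (α (suc zero) · β zero) _ _))
  where
  α″ : Row (ν * 2)
  α″ i = α (suc (suc i))
  row : α ⊛ K (suc ν) ≗ λ where
    zero          → α (suc zero)
    (suc zero)    → α zero
    (suc (suc j)) → (α″ ⊛ K ν) j
  row zero rewrite sum-zero {ν * 2} (λ i → 𝔽.zeroʳ (α″ i)) | 𝔽.zeroʳ (α zero) =
    trans (𝔽.+-identityʳ _) (𝔽.*-identityʳ _)
  row (suc zero) rewrite sum-zero {ν * 2} (λ i → 𝔽.zeroʳ (α″ i)) | 𝔽.zeroʳ (α (suc zero)) =
    trans (𝔽.+-identityʳ _) (𝔽.*-identityʳ _)
  row (suc (suc j)) rewrite 𝔽.zeroʳ (α zero) | 𝔽.zeroʳ (α (suc zero)) = refl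

form-sym : ∀ ν α β → form ν α β ≡ form ν β α
form-sym zero    α β = refl
form-sym (suc ν) α β = begin
  form (suc ν) α β
    ≡⟨ form-suc ν α β ⟩
  (α (suc zero) · β zero +ᶠ α zero · β (suc zero)) +ᶠ form ν _ _
    ≡⟨ cong₂ _+ᶠ_ (trans (𝔽.+-comm (α (suc zero) · β zero) _)
                         (cong₂ _+ᶠ_ (𝔽.*-comm (α zero) _) (𝔽.*-comm (α (suc zero)) _)))
                  (form-sym ν _ _) ⟩
  (β (suc zero) · α zero +ᶠ β zero · α (suc zero)) +ᶠ form ν _ _
    ≡⟨ form-suc ν β α ⟨
  form (suc ν) β α ∎
  where open ≡-Reasoning

form-alternating : ∀ ν α → form ν α α ≡ 0#
form-alternating zero    α = refl
form-alternating (suc ν) α = begin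
  form (suc ν) α α
    ≡⟨ form-suc ν α α ⟩
  (α (suc zero) · α zero +ᶠ α zero · α (suc zero)) +ᶠ form ν _ _
    ≡⟨ cong₂ _+ᶠ_ (trans (cong (_+ᶠ α zero · α (suc zero)) (𝔽.*-comm (α (suc zero)) (α zero)))
                         (𝔽.-‿inverseˡ (α zero · α (suc zero))))
                  (form-alternating ν _) ⟩
  0# ∎
  where open ≡-Reasoning

form-•ˡ : ∀ ν c α β → form ν (c • α) β ≡ c · form ν α β
form-•ˡ ν c α β = begin
  dot ((c • α) ⊛ K ν) β
    ≡⟨ sum-cong-≗ (λ j → cong (_· β j) (trans
         (sum-cong-≗ λ i → 𝔽.*-assoc c (α i) (K ν i j))
         (sym (*-distribˡ-sum c (λ i → α i · K ν i j))))) ⟩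
  dot (c • (α ⊛ K ν)) β
    ≡⟨ sum-cong-≗ (λ j → 𝔽.*-assoc c ((α ⊛ K ν) j) (β j)) ⟩
  ∑[ j < ν * 2 ] (c · ((α ⊛ K ν) j · β j))
    ≡⟨ *-distribˡ-sum c (λ j → (α ⊛ K ν) j · β j) ⟨
  c · dot (α ⊛ K ν) β ∎
  where open ≡-Reasoning

injective⇒surjective : {f : Fin n → Fin n} → Injective _≡_ _≡_ f → ∀ y → ∃[ x ] f x ≡ y
injective⇒surjective {suc n} {f} inj y with any? (λ x → f x ≟ y)
... | yes p = p
... | no ¬p = contradiction (injective⇒≤ {f = λ x → punchOut (y≢f x)} punched) 1+n≰n
  where
  y≢f : ∀ x → y ≢ f x
  y≢f x eq = ¬p (x , sym eq)
  punched : Injective _≡_ _≡_ (λ x → punchOut (y≢f x))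
  punched {a} {b} eq = inj (punchOut-injective (y≢f a) (y≢f b) eq)

funToFin-cong : {f g : Fin m → Fin n} → f ≗ g → funToFin f ≡ funToFin g
funToFin-cong {zero}  p = refl
funToFin-cong {suc m} p = cong₂ combine (p zero) (funToFin-cong (p ∘ suc))

private
  module B = Inverse 2↔Bool

  encode : Row n → Fin (2 ^ n)
  encode α = funToFin (B.from ∘ α)

  decode : Fin (2 ^ n) → Row n
  decode x = B.to ∘ finToFun x

  encode-cong : {α β : Row n} → α ≗ β → encode α ≡ encode β
  encode-cong p = funToFin-cong (cong B.from ∘ p)

  decode-encode : (α : Row n) → decode (encode α) ≗ α
  decode-encode α i =
    trans (cong B.to (finToFun-funToFin (B.from ∘ α) i)) (B.strictlyInverseˡ (α i))

  encode-decode : (x : Fin (2 ^ n)) → encode (decode {n} x) ≡ x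
  encode-decode {n} x =
    trans (funToFin-cong λ i → B.strictlyInverseʳ (finToFun {2} {n} x i)) (funToFin-finToFin {n} {2} x)

  encode-injective : {α β : Row n} → encode α ≡ encode β → α ≗ β
  encode-injective {α = α} {β} p i =
    trans (sym (decode-encode α i)) (trans (cong (λ x → decode x i) p) (decode-encode β i))

-- Multiplication by T permutes the finite set of rows, hence a right inverse is a left inverse.
rightInverse⇒leftInverse : (T S : Matrix n n) → T ⊗ S ≋ 𝟙 → S ⊗ T ≋ 𝟙
rightInverse⇒leftInverse {n} T S TS≋𝟙 i j =
  trans (sym (⊛-identityˡ i (S ⊗ T) j)) (fixes (𝟙 i) j)
  where
  cancel : ∀ α → α ⊛ T ⊛ S ≗ α
  cancel α j = trans (⊛-assoc α T S j) (trans (⊛-cong {α = α} (λ _ → refl) TS≋𝟙 j) (⊛-identityʳ α j))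

  step : Fin (2 ^ n) → Fin (2 ^ n)
  step x = encode (decode {n} x ⊛ T)

  step-injective : Injective _≡_ _≡_ step
  step-injective {x} {y} p =
    trans (sym (encode-decode {n} x)) (trans (encode-cong eq) (encode-decode {n} y))
    where
    eq : decode {n} x ≗ decode {n} y
    eq i = trans (sym (cancel (decode x) i))
      (trans (⊛-cong {M = S} (encode-injective p) (λ _ _ → refl) i) (cancel (decode y) i))

  surj : ∀ β → ∃[ α ] α ⊛ T ≗ β
  surj β = let x , p = injective⇒surjective step-injective (encode β)
           in decode x , encode-injective p

  fixes : ∀ β → β ⊛ (S ⊗ T) ≗ β
  fixes β j = let α , p = surj β in begin
    (β ⊛ (S ⊗ T)) j   ≡⟨ ⊛-assoc β S T j ⟨
    (β ⊛ S ⊛ T) j     ≡⟨ ⊛-cong {M = T} (⊛-cong {M = S} p (λ _ _ → refl)) (λ _ _ → refl) j ⟨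
    (α ⊛ T ⊛ S ⊛ T) j ≡⟨ ⊛-cong {M = T} (cancel α) (λ _ _ → refl) j ⟩
    (α ⊛ T) j         ≡⟨ p j ⟩
    β j               ∎
    where open ≡-Reasoning

span : Row n → Pred (Row n) 0ℓ
span α β = ∃[ c ] β ≗ c • α

-- A one-dimensional subspace is given by a nonzero spanning row;
-- two of them are equal when the spans agree as sets of rows.
record Line (n : ℕ) : Set where
  constructor [_∣_]
  field
    row     : Row n
    nonzero : ¬ (row ≗ 𝟘)

open Line

lines : ℕ → Setoid 0ℓ 0ℓ
lines n = record
  { Carrier       = Line n
  ; _≈_           = λ x y → span (row x) ≐ span (row y)
  ; isEquivalence = record
    { refl = ≐-refl ; sym = ≐-sym ; trans = ≐-trans }
  }

Sp : ∀ ν → Graph 0ℓ 0ℓ 0ℓ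
Sp ν = record
  { vertices = lines (ν * 2)
  ; _~_      = _~_
  ; ~-resp-≈ = λ {x} {x′} {y} {y′} p q →
      sym~ {y′} {x′} ∘ respˡ {y} {y′} {x′} q ∘ sym~ {x′} {y} ∘ respˡ {x} {x′} {y} p
  ; ~-sym    = λ {x} {y} → sym~ {x} {y}
  ; ~-irrefl = λ {x} x~x → x~x (form-alternating ν (row x))
  }
  where
  _~_ : Rel (Line (ν * 2)) 0ℓ
  x ~ y = form ν (row x) (row y) ≢ 0#

  sym~ : ∀ {x y} → x ~ y → y ~ x
  sym~ {x} {y} x~y eq = x~y (trans (form-sym ν (row x) (row y)) eq)

  respˡ : ∀ {x x′ y} → span (row x) ≐ span (row x′) → x ~ y → x′ ~ y
  respˡ {x} {x′} {y} (x⊆x′ , _) x~y eq =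
    let d , x≗dx′ = x⊆x′ (1# , λ i → sym (𝔽.*-identityˡ (row x i)))
    in x~y (begin
      form ν (row x) (row y)        ≡⟨ form-cong ν x≗dx′ (λ _ → refl) ⟩
      form ν (d • row x′) (row y)   ≡⟨ form-•ˡ ν d (row x′) (row y) ⟩
      d · form ν (row x′) (row y)   ≡⟨ cong (d ·_) eq ⟩
      d · 0#                        ≡⟨ 𝔽.zeroʳ d ⟩
      0#                            ∎)
    where open ≡-Reasoning

record SymplecticMatrix (ν : ℕ) : Set where
  field
    matrix     : Matrix (ν * 2) (ν * 2)
    symplectic : matrix ⊗ K ν ⊗ ᵗ matrix ≋ K ν

module _ (ν : ℕ) where
  open SymplecticMatrix
  open SetoidReasoning (matrixSetoid (ν * 2) (ν * 2))

  private
    -- From T K ᵗT = K and K ᵗK = 1.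
    inv : Matrix (ν * 2) (ν * 2) → Matrix (ν * 2) (ν * 2)
    inv T = K ν ⊗ ᵗ T ⊗ ᵗ K ν

    congruence : (S T M : Matrix (ν * 2) (ν * 2)) →
      (S ⊗ T) ⊗ M ⊗ ᵗ (S ⊗ T) ≋ S ⊗ (T ⊗ M ⊗ ᵗ T) ⊗ ᵗ S
    congruence S T M = begin
      S ⊗ T ⊗ M ⊗ ᵗ (S ⊗ T)    ≈⟨ ⊗-cong (⊗-assoc S T M) (ᵗ-⊗ S T) ⟩
      S ⊗ (T ⊗ M) ⊗ (ᵗ T ⊗ ᵗ S) ≈⟨ ⊗-assoc (S ⊗ (T ⊗ M)) (ᵗ T) (ᵗ S) ⟨
      S ⊗ (T ⊗ M) ⊗ ᵗ T ⊗ ᵗ S   ≈⟨ ⊗-cong (⊗-assoc S (T ⊗ M) (ᵗ T)) (≋.refl {x = ᵗ S}) ⟩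
      S ⊗ (T ⊗ M ⊗ ᵗ T) ⊗ ᵗ S   ∎

    ᵗ𝟙≋𝟙 : ᵗ 𝟙 ≋ 𝟙 {ν * 2}
    ᵗ𝟙≋𝟙 i j = 𝟙-sym j i

    𝟙-symplectic : 𝟙 ⊗ K ν ⊗ ᵗ 𝟙 ≋ K ν
    𝟙-symplectic = begin
      𝟙 ⊗ K ν ⊗ ᵗ 𝟙 ≈⟨ ⊗-cong (⊗-identityˡ (K ν)) ᵗ𝟙≋𝟙 ⟩
      K ν ⊗ 𝟙       ≈⟨ ⊗-identityʳ (K ν) ⟩
      K ν           ∎

    invʳ : (T : SymplecticMatrix ν) → matrix T ⊗ inv (matrix T) ≋ 𝟙
    invʳ T = begin
      matrix T ⊗ (K ν ⊗ ᵗ matrix T ⊗ ᵗ K ν)   ≈⟨ ⊗-assoc (matrix T) (K ν ⊗ ᵗ matrix T) (ᵗ K ν) ⟨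
      matrix T ⊗ (K ν ⊗ ᵗ matrix T) ⊗ ᵗ K ν   ≈⟨ ⊗-cong (⊗-assoc (matrix T) (K ν) (ᵗ matrix T)) (≋.refl {x = ᵗ K ν}) ⟨
      matrix T ⊗ K ν ⊗ ᵗ matrix T ⊗ ᵗ K ν     ≈⟨ ⊗-cong (symplectic T) (≋.refl {x = ᵗ K ν}) ⟩
      K ν ⊗ ᵗ K ν                             ≈⟨ K-ᵗK ν ⟩
      𝟙                                       ∎

    invˡ : (T : SymplecticMatrix ν) → inv (matrix T) ⊗ matrix T ≋ 𝟙
    invˡ T = rightInverse⇒leftInverse (matrix T) (inv (matrix T)) (invʳ T)

    inv-symplectic : (T : SymplecticMatrix ν) → inv (matrix T) ⊗ K ν ⊗ ᵗ inv (matrix T) ≋ K ν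
    inv-symplectic T = let S = inv (matrix T) in begin
      S ⊗ K ν ⊗ ᵗ S
        ≈⟨ ⊗-cong (⊗-cong (≋.refl {x = S}) (symplectic T)) (≋.refl {x = ᵗ S}) ⟨
      S ⊗ (matrix T ⊗ K ν ⊗ ᵗ matrix T) ⊗ ᵗ S
        ≈⟨ congruence S (matrix T) (K ν) ⟨
      (S ⊗ matrix T) ⊗ K ν ⊗ ᵗ (S ⊗ matrix T)
        ≈⟨ ⊗-cong (⊗-cong (invˡ T) (≋.refl {x = K ν})) (λ i j → trans (invˡ T j i) (𝟙-sym j i)) ⟩
      𝟙 ⊗ K ν ⊗ 𝟙
        ≈⟨ ⊗-cong (⊗-identityˡ (K ν)) (≋.refl {x = 𝟙}) ⟩
      K ν ⊗ 𝟙
        ≈⟨ ⊗-identityʳ (K ν) ⟩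
      K ν ∎

  SymplecticGroup : Group 0ℓ 0ℓ
  SymplecticGroup = record
    { Carrier = SymplecticMatrix ν
    ; _≈_     = λ (S T : SymplecticMatrix ν) → matrix S ≋ matrix T
    ; _∙_     = λ S T → record
      { matrix     = matrix S ⊗ matrix T
      ; symplectic = begin
          (matrix S ⊗ matrix T) ⊗ K ν ⊗ ᵗ (matrix S ⊗ matrix T)
            ≈⟨ congruence (matrix S) (matrix T) (K ν) ⟩
          matrix S ⊗ (matrix T ⊗ K ν ⊗ ᵗ matrix T) ⊗ ᵗ matrix S
            ≈⟨ ⊗-cong (⊗-cong (≋.refl {x = matrix S}) (symplectic T)) (≋.refl {x = ᵗ matrix S}) ⟩
          matrix S ⊗ K ν ⊗ ᵗ matrix S
            ≈⟨ symplectic S ⟩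
          K ν ∎
      }
    ; ε       = record { matrix = 𝟙 ; symplectic = 𝟙-symplectic }
    ; _⁻¹     = λ T → record { matrix = inv (matrix T) ; symplectic = inv-symplectic T }
    ; isGroup = record
      { isMonoid = record
        { isSemigroup = record
          { isMagma = record
            { isEquivalence = record
              { refl  = λ _ _ → refl
              ; sym   = λ p i j → sym (p i j)
              ; trans = λ p q i j → trans (p i j) (q i j)
              }
            ; ∙-cong = ⊗-cong
            }
          ; assoc = λ R S T → ⊗-assoc (matrix R) (matrix S) (matrix T)
          }
        ; identity = (λ T → ⊗-identityˡ (matrix T)) , (λ T → ⊗-identityʳ (matrix T))
        }
      ; inverse = invˡ , invʳ
      ; ⁻¹-cong = λ {S} {T} p →
          ⊗-cong (⊗-cong (≋.refl {x = K ν}) (λ i j → p j i)) (≋.refl {x = ᵗ K ν})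
      }
    }

{-# OPTIONS --safe #-}
-- Over 𝔽₂ a line has exactly one nonzero row and nonvanishing determines the value of the form,
-- so an automorphism is an isometric permutation g of the nonzero rows.  For every β,
--   form (g α) (g β) = form α β = Σ αᵢ form eᵢ β = form (Σ αᵢ g eᵢ) (g β);
-- as g β runs through all nonzero rows, nondegeneracy makes g the symplectic matrix with rows g eᵢ.
-- Matrices act from the right, so σ is sent to the matrix of σ⁻¹.
module Submission where

open import Defs
open import Data.Nat using (ℕ; _≤_)
open import Algebra.Bundles using (Group)
open import Algebra.Morphism.Structures using (module GroupMorphisms)
import Algebra.Properties.Group as GroupProperties
open import Data.Bool.Base using (true; false; _∧_)
open import Data.Fin.Base using (Fin; zero; suc)
open import Data.Nat.Base using (_*_)
open import Data.Product.Base using (_,_)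
open import Function.Base using (_∘_)
open import Function.Bundles using (Equivalence; Inverse; _⇔_; mk⇔)
open import Relation.Binary.Bundles using (Setoid)
open import Relation.Binary.PropositionalEquality
  using (_≡_; _≢_; _≗_; refl; sym; trans; cong; module ≡-Reasoning)
open import Relation.Nullary.Negation using (contradiction)

open Line
open SymplecticMatrix
open Automorphism using (inverse; preserves; to; from)

private variable
  m n : ℕ

≢false-injective : ∀ {a b} → a ≢ false ⇔ b ≢ false → a ≡ b
≢false-injective {false} {false} e = refl
≢false-injective {true}  {true}  e = refl
≢false-injective {false} {true}  e = contradiction refl (Equivalence.from e λ ())
≢false-injective {true}  {false} e = contradiction refl (Equivalence.to e λ ())

⊛-congˡ : {α β : Row m} (M : Matrix m n) → α ≗ β → α ⊛ M ≗ β ⊛ M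
⊛-congˡ M p = ⊛-cong {M = M} p λ _ _ → refl

⊛-congʳ : (α : Row m) {M N : Matrix m n} → M ≋ N → α ⊛ M ≗ α ⊛ N
⊛-congʳ α q = ⊛-cong {α = α} (λ _ → refl) q

𝟘-⊛ : (M : Matrix m n) → 𝟘 ⊛ M ≗ 𝟘
𝟘-⊛ {m} M j = sum-zero {m} λ _ → refl

𝟙-diagonal : (i : Fin n) → 𝟙 i i ≡ true
𝟙-diagonal zero    = refl
𝟙-diagonal (suc i) = 𝟙-diagonal i

basis : Fin n → Line n
basis i = [ 𝟙 i ∣ (λ p → contradiction (trans (sym (𝟙-diagonal i)) (p i)) λ ()) ]

-- `row x` is a multiple of `row y`; the scalar `false` would make `row x` zero, so it is `true`.
row-cong : {x y : Line n} → Setoid._≈_ (lines n) x y → row x ≗ row y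
row-cong {x = x} (p , _) with p (true , λ _ → refl)
... | true  , q = q
... | false , q = contradiction q (nonzero x)

row-injective : {x y : Line n} → row x ≗ row y → Setoid._≈_ (lines n) x y
row-injective p = (λ (c , q) → c , λ i → trans (q i) (cong (c ∧_) (p i)))
                , (λ (c , q) → c , λ i → trans (q i) (cong (c ∧_) (sym (p i))))

-- The test lines for nondegeneracy. A zero row of K would give K ᵗK = 1 a zero diagonal entry.
K-row : ∀ ν → Fin (ν * 2) → Line (ν * 2)
K-row ν j = [ K ν j ∣ (λ p → contradiction (trans (sym diagonal) (vanishes p)) λ ()) ]
  where
  diagonal : (K ν j ⊛ ᵗ K ν) j ≡ true
  diagonal = trans (K-ᵗK ν j j) (𝟙-diagonal j)
  vanishes : K ν j ≗ 𝟘 → (K ν j ⊛ ᵗ K ν) j ≡ false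
  vanishes p = trans (⊛-congˡ (ᵗ K ν) p j) (𝟘-⊛ (ᵗ K ν) j)

-- form ν α (K ν j) is the j-th entry of α K ᵗK = α.
form-nondegenerate : ∀ ν {α β} →
  (∀ y → form ν α (row y) ≡ form ν β (row y)) → α ≗ β
form-nondegenerate ν {α} {β} p j = begin
  α j                 ≡⟨ cancel α ⟨
  form ν α (K ν j)    ≡⟨ p (K-row ν j) ⟩
  form ν β (K ν j)    ≡⟨ cancel β ⟩
  β j                 ∎
  where
  open ≡-Reasoning
  cancel : ∀ γ → (γ ⊛ K ν ⊛ ᵗ K ν) j ≡ γ j
  cancel γ = trans (⊛-assoc γ (K ν) (ᵗ K ν) j)
    (trans (⊛-congʳ γ (K-ᵗK ν) j) (⊛-identityʳ γ j))

-- With `β` read as a one-column matrix, linearity in the first argument is associativity applied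
-- twice.
form-⊛ˡ : ∀ ν (α : Row m) (M : Matrix m (ν * 2)) β →
  form ν (α ⊛ M) β ≡ dot α (λ i → form ν (M i) β)
form-⊛ˡ ν α M β = trans
  (⊛-congˡ B (⊛-assoc α M (K ν)) zero)
  (⊛-assoc α (M ⊗ K ν) B zero)
  where
  B : Matrix (ν * 2) 1
  B i _ = β i

-- (αT) K ᵗ(βT) regroups as α (T K ᵗT) ᵗβ. Taking `β` as a one-row matrix makes `ᵗ-⊗` applicable.
form-⊛ : ∀ ν (T : Matrix (ν * 2) (ν * 2)) → T ⊗ K ν ⊗ ᵗ T ≋ K ν →
  ∀ α β → form ν (α ⊛ T) (β ⊛ T) ≡ form ν α β
form-⊛ ν T p α β = begin
  (α ⊛ T ⊛ K ν ⊛ ᵗ (B ⊗ T)) zero         ≡⟨ ⊛-congʳ (α ⊛ T ⊛ K ν) (ᵗ-⊗ B T) zero ⟩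
  (α ⊛ T ⊛ K ν ⊛ (ᵗ T ⊗ ᵗ B)) zero       ≡⟨ ⊛-assoc (α ⊛ T ⊛ K ν) (ᵗ T) (ᵗ B) zero ⟨
  (α ⊛ T ⊛ K ν ⊛ ᵗ T ⊛ ᵗ B) zero         ≡⟨ ⊛-congˡ (ᵗ B) TKᵗT zero ⟩
  (α ⊛ K ν ⊛ ᵗ B) zero                   ∎
  where
  open ≡-Reasoning
  B : Matrix 1 (ν * 2)
  B _ = β
  TKᵗT : α ⊛ T ⊛ K ν ⊛ ᵗ T ≗ α ⊛ K ν
  TKᵗT j = begin
    (α ⊛ T ⊛ K ν ⊛ ᵗ T) j     ≡⟨ ⊛-congˡ (ᵗ T) (⊛-assoc α T (K ν)) j ⟩
    (α ⊛ (T ⊗ K ν) ⊛ ᵗ T) j   ≡⟨ ⊛-assoc α (T ⊗ K ν) (ᵗ T) j ⟩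
    (α ⊛ (T ⊗ K ν ⊗ ᵗ T)) j   ≡⟨ ⊛-congʳ α p j ⟩
    (α ⊛ K ν) j               ∎

module _ (ν : ℕ) where
  private
    module A = Group (Aut (Sp ν))
    module S = Group (SymplecticGroup ν)

  image-of-basis : Automorphism (Sp ν) → Matrix (ν * 2) (ν * 2)
  image-of-basis g i = row (to g (basis i))

  form-preserved : (g : Automorphism (Sp ν)) → ∀ x y →
    form ν (row (to g x)) (row (to g y)) ≡ form ν (row x) (row y)
  form-preserved g x y = sym (≢false-injective (preserves g x y))

  form-K : ∀ i j → form ν (𝟙 i) (𝟙 j) ≡ K ν i j
  form-K i j = begin
    (𝟙 i ⊛ K ν ⊛ ᵗ 𝟙) j   ≡⟨ ⊛-congʳ (𝟙 i ⊛ K ν) (λ a b → 𝟙-sym b a) j ⟩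
    (𝟙 i ⊛ K ν ⊛ 𝟙) j     ≡⟨ ⊛-identityʳ (𝟙 i ⊛ K ν) j ⟩
    (𝟙 i ⊛ K ν) j         ≡⟨ ⊛-identityˡ i (K ν) j ⟩
    K ν i j               ∎
    where open ≡-Reasoning

  automorphism-linear : (g : Automorphism (Sp ν)) → ∀ x →
    row (to g x) ≗ row x ⊛ image-of-basis g
  automorphism-linear g x = form-nondegenerate ν λ y →
    let z = from g y
        gz≗y = row-cong {x = to g z} {y} (Inverse.strictlyInverseˡ (inverse g) y)
    in begin
      form ν (row (to g x)) (row y)
        ≡⟨ form-cong ν {α = row (to g x)} (λ _ → refl) gz≗y ⟨
      form ν (row (to g x)) (row (to g z))
        ≡⟨ form-preserved g x z ⟩
      form ν (row x) (row z)
        -- Only the form is known to be additive, not `g`: `row x` is expanded in unit rows inside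
        -- the form, and preservation is applied to each pair `basis i`, `z`.
        ≡⟨ form-cong ν {β = row z} (⊛-identityʳ (row x)) (λ _ → refl) ⟨
      form ν (row x ⊛ 𝟙) (row z)
        ≡⟨ form-⊛ˡ ν (row x) 𝟙 (row z) ⟩
      dot (row x) (λ i → form ν (𝟙 i) (row z))
        ≡⟨ dot-cong {α = row x} (λ _ → refl) (λ i → form-preserved g (basis i) z) ⟨
      dot (row x) (λ i → form ν (image-of-basis g i) (row (to g z)))
        ≡⟨ form-⊛ˡ ν (row x) (image-of-basis g) (row (to g z)) ⟨
      form ν (row x ⊛ image-of-basis g) (row (to g z))
        ≡⟨ form-cong ν {α = row x ⊛ image-of-basis g} (λ _ → refl) gz≗y ⟩
      form ν (row x ⊛ image-of-basis g) (row y) ∎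
    where open ≡-Reasoning

  toMatrix : Automorphism (Sp ν) → SymplecticMatrix ν
  toMatrix f = record
    { matrix     = image-of-basis (f A.⁻¹)
    -- Entry (i, j) of T K ᵗT unfolds to the form of rows i and j of T, which here are images of
    -- unit rows.
    ; symplectic = λ i j → trans (form-preserved (f A.⁻¹) (basis i) (basis j)) (form-K i j)
    }

  ⊛-cancel : ∀ S T → S S.∙ T S.≈ S.ε → ∀ α → α ⊛ matrix S ⊛ matrix T ≗ α
  ⊛-cancel S T p α j = trans (⊛-assoc α (matrix S) (matrix T) j)
    (trans (⊛-congʳ α p j) (⊛-identityʳ α j))

  act : SymplecticMatrix ν → Line (ν * 2) → Line (ν * 2)
  act T x = [ row x ⊛ matrix T ∣ (λ p → nonzero x λ j →
    trans (sym (⊛-cancel T (T S.⁻¹) (S.inverseʳ T) (row x) j))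
          (trans (⊛-congˡ (matrix (T S.⁻¹)) p j) (𝟘-⊛ (matrix (T S.⁻¹)) j))) ]

  act-cong : ∀ T {x y} → Setoid._≈_ (lines (ν * 2)) x y →
    Setoid._≈_ (lines (ν * 2)) (act T x) (act T y)
  act-cong T {x} {y} p = row-injective {x = act T x} {act T y}
    (⊛-congˡ (matrix T) (row-cong {x = x} {y} p))

  -- Stated for a one-sided pair so that both halves of an `Inverse` follow by exchanging a matrix
  -- with its inverse.
  act-inverse : ∀ S T → S S.∙ T S.≈ S.ε → ∀ {x y} →
    Setoid._≈_ (lines (ν * 2)) y (act S x) → Setoid._≈_ (lines (ν * 2)) (act T y) x
  act-inverse S T p {x} {y} q = row-injective {x = act T y} {x} λ j →
    trans (⊛-congˡ (matrix T) (row-cong {x = y} {act S x} q) j) (⊛-cancel S T p (row x) j)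

  fromMatrix : SymplecticMatrix ν → Automorphism (Sp ν)
  fromMatrix T = record
    { inverse   = record
      { to        = act T
      ; from      = act (T S.⁻¹)
      ; to-cong   = λ {x} {y} → act-cong T {x} {y}
      ; from-cong = λ {x} {y} → act-cong (T S.⁻¹) {x} {y}
      ; inverse   = (λ {x} {y} → act-inverse (T S.⁻¹) T (S.inverseˡ T) {x} {y})
                  , (λ {x} {y} → act-inverse T (T S.⁻¹) (S.inverseʳ T) {x} {y})
      }
    ; preserves = λ x y →
        let isometry = form-⊛ ν (matrix T) (symplectic T) (row x) (row y)
        in mk⇔ (λ p → p ∘ trans (sym isometry)) (λ p → p ∘ trans isometry)
    }

  open GroupMorphisms A.rawGroup S.rawGroup

  toMatrix-cong : ∀ {f g} → f A.≈ g → toMatrix f S.≈ toMatrix g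
  toMatrix-cong {f} {g} p i = row-cong {x = from f (basis i)} {from g (basis i)} (A.⁻¹-cong {f} {g} p (basis i))

  -- The inverse of `f A.∙ g` applies `from f` first and then `from g`. Row i is thus `from g` at
  -- the line spanned by row i of `toMatrix f`, and linearity of `from g` makes it a product.
  toMatrix-homo : ∀ f g → toMatrix (f A.∙ g) S.≈ toMatrix f S.∙ toMatrix g
  toMatrix-homo f g i = automorphism-linear (g A.⁻¹) (from f (basis i))

  toMatrix-⁻¹ : ∀ f → toMatrix (f A.⁻¹) S.≈ toMatrix f S.⁻¹
  toMatrix-⁻¹ f = GroupProperties.inverseˡ-unique (SymplecticGroup ν)
    (toMatrix (f A.⁻¹)) (toMatrix f)
    (S.trans {toMatrix (f A.⁻¹) S.∙ toMatrix f} {toMatrix (f A.⁻¹ A.∙ f)} {S.ε}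
      (S.sym {toMatrix (f A.⁻¹ A.∙ f)} {toMatrix (f A.⁻¹) S.∙ toMatrix f} (toMatrix-homo (f A.⁻¹) f))
      -- `toMatrix A.ε` has the rows of `𝟙` by computation, so it serves as `S.ε`.
      (toMatrix-cong {f A.⁻¹ A.∙ f} {A.ε} (A.inverseˡ f)))

  -- By linearity the matrix determines `from f` on every line, not only on the basis. Inverting
  -- again recovers `f`, as `f A.⁻¹ A.⁻¹` has the same `to`.
  toMatrix-injective : ∀ {f g} → toMatrix f S.≈ toMatrix g → f A.≈ g
  toMatrix-injective {f} {g} p = A.⁻¹-cong {f A.⁻¹} {g A.⁻¹} λ x →
    row-injective {x = from f x} {from g x} λ j →
      trans (automorphism-linear (f A.⁻¹) x j)
        (trans (⊛-congʳ (row x) p j) (sym (automorphism-linear (g A.⁻¹) x j)))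

  -- The two inversions cancel, leaving `act T` on the basis.
  toMatrix-fromMatrix : ∀ T → toMatrix (fromMatrix T A.⁻¹) S.≈ T
  toMatrix-fromMatrix T i = ⊛-identityˡ i (matrix T)

  toMatrix-isGroupIsomorphism : IsGroupIsomorphism toMatrix
  toMatrix-isGroupIsomorphism = record
    { isGroupMonomorphism = record
      { isGroupHomomorphism = record
        { isMonoidHomomorphism = record
          { isMagmaHomomorphism = record
            { isRelHomomorphism = record { cong = λ {f} {g} → toMatrix-cong {f} {g} }
            ; homo = toMatrix-homo
            }
          ; ε-homo = λ _ _ → refl
          }
        ; ⁻¹-homo = toMatrix-⁻¹
        }
      ; injective = λ {f} {g} → toMatrix-injective {f} {g}
      }
    ; surjective = λ T → fromMatrix T A.⁻¹ , λ {f} p →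
        S.trans {toMatrix f} {toMatrix (fromMatrix T A.⁻¹)} {T}
          (toMatrix-cong {f} {fromMatrix T A.⁻¹} p) (toMatrix-fromMatrix T)
    }

proposition3p3 : ∀ (ν : ℕ) → 1 ≤ ν → Aut (Sp ν) ≅ SymplecticGroup ν
proposition3p3 ν _ = toMatrix ν , toMatrix-isGroupIsomorphism ν
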